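{- Let $\Gamma$ be a finite constraint language over a finite domain $D$. The following are equivalent: 1. $\Gamma$ has symmetric polymorphisms of all arities. 2. For all satisfiable instances $I=(X,D,C)\in\mathrm{CSP}(\Gamma)$ there exists a satisfying assignment $\nu:X\to D$ such that for all pairs of variables $x,x'\in X$, if $x\sim_\delta x'$ then $\nu(x)=\nu(x')$.
   Context: **CSP.** An instance of CSP is a triple $I=(X,D,C)$ with $X$ a finite set of variables, $D$ a finite domain, and $C$ a finite set of constraints; a constraint is a pair $c=(\mathbf{s},R)$ with $R\subseteq D^k$ a relation of arity $k\ge 1$ and $\mathbf{s}$ (the scope) a $k$-tuple of variables. Write $x\in c$ if $x$ occurs in the scope of $c$. An assignment $\nu:X\to D$ is satisfying if $\nu(\mathbf{s})\in R$ (coordinate-wise) for all $(\mathbf{s},R)\in C$. A constraint language $\Gamma$ is a set of relations over $D$; $\mathrm{CSP}(\Gamma)$ is the set of instances all of whose constraint relations lie in $\Gamma$. **Iterated degree.** The factor graph $G_I$ of $I$ (not necessarily connected) is the bipartite graph with vertex set $X\cup C$ and edges $\{x,c\}$ for $x\in c$; the edge between $x$ and $c=(\mathbf{s},R)$ has label $\ell_{x,c}=\ell_{c,x}=(S,R)$ where $S=\{i : \mathbf{s}[i]=x\}$. $N(v)$ is the neighbourhood of $v$ in $G_I$. Let $\delta_0$ be one fixed symbol on all variables and another, different fixed symbol on all constraints. For $k\ge 1$ and a node $v$, the $k$-th iterated degree $\delta_k(v)$ is the multiset $\{(\ell_{v,w},\delta_{k-1}(w)) : w\in N(v)\}$. Write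 $v\sim_\delta v'$ if $\delta_k(v)=\delta_k(v')$ for all $k\ge 0$. **Polymorphisms.** An operation $f:D^\ell\to D$ is a polymorphism of $\Gamma$ if for every $R\in\Gamma$ and all $\mathbf{t}_1,\dots,\mathbf{t}_\ell\in R$, applying $f$ coordinate-wise to $\mathbf{t}_1,\dots,\mathbf{t}_\ell$ yields a tuple in $R$. It is symmetric if $f(x_1,\dots,x_\ell)=f(x_{\sigma(1)},\dots,x_{\sigma(\ell)})$ for all $x_1,\dots,x_\ell\in D$ and all permutations $\sigma$ of $\{1,\dots,\ell\}$. -}

module Defs where

open import Level using (0ℓ)
open import Data.Nat using (ℕ; zero; suc; _^_; NonZero)
open import Data.Fin using (Fin; _≟_; funToFin)
open import Data.Fin.Permutation using (Permutation′; _⟨$⟩ʳ_)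
open import Data.Fin.Subset using (Subset) renaming (_∈_ to _∈ˢ_)
open import Data.List using (List; length; filter; allFin)
import Data.List as List
open import Data.List.Membership.Propositional using () renaming (_∈_ to _∈ˡ_)
import Data.List.Relation.Binary.Permutation.Setoid as Permutation
open import Data.List.Relation.Unary.Unique.Propositional using (Unique)
open import Data.Product using (Σ; ∃-syntax; _×_; _,_)
open import Data.Product.Relation.Binary.Pointwise.NonDependent using (_×ₛ_)
open import Data.Sum using (_⊎_; inj₁; inj₂)
open import Data.Vec using (Vec; lookup; map; tabulate; transpose)
import Data.Vec.Membership.DecPropositional as DecMembership
open import Relation.Binary.Bundles using (Setoid)
open import Relation.Binary.PropositionalEquality using (_≡_; setoid)
open import Relation.Nullary using (does)

-- The domain is D = Fin d throughout.

-- A relation R ⊆ D^k is given by its characteristic vector on D^k, where a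
-- tuple is identified with an element of Fin (d ^ k) by the bijection funToFin.
-- Consequently _≡_ on relations is equality of arities and of sets of tuples,
-- and is decidable.
record Relation (d : ℕ) : Set where
  constructor mkRelation
  field
    arity        : ℕ
    .{{arity≢0}} : NonZero arity
    tuples       : Subset (d ^ arity)

open Relation public

infix 4 _∈ᴿ_

_∈ᴿ_ : ∀ {d k} → Vec (Fin d) k → Subset (d ^ k) → Set
t ∈ᴿ T = funToFin (lookup t) ∈ˢ T

-- A finite set of relations, listed; only membership in the list is ever used,
-- so order and repetitions are immaterial.
Language : ℕ → Set
Language d = List (Relation d)

record Constraint (d n : ℕ) : Set where
  constructor mkConstraint
  field
    rel   : Relation d
    scope : Vec (Fin n) (arity rel)

open Constraint public

-- The variables are X = Fin n. The constraints form a set, hence `distinct`: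
-- iterated degrees count constraints.
record Instance (d : ℕ) : Set where
  field
    n           : ℕ
    constraints : List (Constraint d n)
    distinct    : Unique constraints

  Assignment : Set
  Assignment = Fin n → Fin d

  Satisfies : Assignment → Set
  Satisfies ν = ∀ {c} → c ∈ˡ constraints → map ν (scope c) ∈ᴿ tuples (rel c)

  Satisfiable : Set
  Satisfiable = ∃[ ν ] Satisfies ν

CSP : ∀ {d} → Language d → Instance d → Set
CSP Γ I = ∀ {c} → c ∈ˡ Instance.constraints I → rel c ∈ˡ Γ

-- An edge label (S , R), with the relation first as S is a subset of its positions.
Label : ℕ → Set
Label d = Σ (Relation d) λ R → Subset (arity R)

data Kind : Set where
  variableᵏ constraintᵏ : Kind

-- The values of the k-th iterated degree. Multisets are lists up to permutation,
-- where entries are compared by equality of labels and, recursively, by equality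
-- of (k-1)-st iterated degrees.
Degree : ℕ → ℕ → Setoid 0ℓ 0ℓ
Degree d zero    = setoid Kind
Degree d (suc k) = Permutation.↭-setoid (setoid (Label d) ×ₛ Degree d k)

module FactorGraph {d : ℕ} (I : Instance d) where
  open Instance I
  open DecMembership (_≟_ {n}) using (_∈?_)

  -- Constraint nodes are positions in the duplicate-free list of constraints.
  Node : Set
  Node = Fin n ⊎ Fin (length constraints)

  constraint : Fin (length constraints) → Constraint d n
  constraint = List.lookup constraints

  constraintsOf : Fin n → List (Fin (length constraints))
  constraintsOf x = filter (λ j → x ∈? scope (constraint j)) (allFin _)

  variablesOf : Fin (length constraints) → List (Fin n)
  variablesOf j = filter (λ x → x ∈? scope (constraint j)) (allFin _)

  label : Fin n → Fin (length constraints) → Label d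
  label x j = rel (constraint j) , map (λ y → does (y ≟ x)) (scope (constraint j))

  δ : ∀ k → Node → Setoid.Carrier (Degree d k)
  δ zero    (inj₁ x) = variableᵏ
  δ zero    (inj₂ j) = constraintᵏ
  δ (suc k) (inj₁ x) = List.map (λ j → label x j , δ k (inj₂ j)) (constraintsOf x)
  δ (suc k) (inj₂ j) = List.map (λ x → label x j , δ k (inj₁ x)) (variablesOf j)

  infix 4 _∼δ_

  _∼δ_ : Node → Node → Set
  v ∼δ v′ = ∀ k → Setoid._≈_ (Degree d k) (δ k v) (δ k v′)

Operation : ℕ → ℕ → Set
Operation d ℓ = Vec (Fin d) ℓ → Fin d

-- The vector ts holds ℓ tuples t₁ , … , t_ℓ; the i-th row of its transpose
-- holds their i-th coordinates.
Polymorphism : ∀ {d ℓ} → Language d → Operation d ℓ → Set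
Polymorphism {d} {ℓ} Γ f =
  ∀ {R} → R ∈ˡ Γ → (ts : Vec (Vec (Fin d) (arity R)) ℓ) →
  (∀ j → lookup ts j ∈ᴿ tuples R) →
  map f (transpose ts) ∈ᴿ tuples R

Symmetric : ∀ {d ℓ} → Operation d ℓ → Set
Symmetric {d} {ℓ} f =
  ∀ (xs : Vec (Fin d) ℓ) (σ : Permutation′ ℓ) →
  f xs ≡ f (tabulate λ i → lookup xs (σ ⟨$⟩ʳ i))

-- Arities of operations are at least 1.
HasSymmetricPolymorphismsOfAllArities : ∀ {d} → Language d → Set
HasSymmetricPolymorphismsOfAllArities {d} Γ =
  ∀ ℓ .{{_ : NonZero ℓ}} → ∃[ f ] (Polymorphism {d} {ℓ} Γ f × Symmetric f)

{-# OPTIONS --safe #-}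
module Submission where

-- From symmetric polymorphisms to invariant assignments: refine the trivial
-- partitions of variables and constraints by counting neighbours until nothing
-- changes. In a stable partition the variables at a fixed position of the
-- constraints of a class C run through a class V, hitting each variable of V
-- equally often, say μ times, so |C| = μ |V|. Take L divisible by all class sizes
-- and f symmetric of arity L. Given a solution ν₀, let ν(x) be f applied to the
-- values of ν₀ on the class of x, each repeated equally often. Applying f to the
-- tuples of ν₀ on the class of a constraint, each repeated equally often, then
-- yields exactly the tuple of ν, since both multisets agree in each coordinate.
--
-- Conversely, take the tuples in D^ℓ as variables and constrain them by all
-- conditions that every projection satisfies. Solutions of this instance are the
-- ℓ-ary polymorphisms, and a permutation of the coordinates is an automorphism of
-- it, hence preserves iterated degrees.

open import Defs
open import Data.Bool using (true)
import Data.Bool.Properties as Bool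
open import Data.Fin using (Fin; zero; suc; _≟_; punchIn; funToFin; finToFun; combine)
open import Data.Fin.Permutation as Perm
  using (Permutation′; _⟨$⟩ʳ_; _⟨$⟩ˡ_; inverseˡ; inverseʳ; insert; insert-punchIn)
open import Data.Fin.Properties using (all?; finToFun-funToFin; funToFin-finToFin)
open import Data.Fin.Subset using (Subset)
import Data.Fin.Subset.Properties as Subset
open import Data.List using (List; []; _∷_; filter; allFin; concatMap; deduplicate)
import Data.List as List
open import Data.List.Membership.Propositional using (_∈_; lose)
open import Data.List.Membership.Propositional.Properties
  using (∈-allFin; ∈-map⁺; ∈-map⁻; ∈-++⁺ˡ; ∈-++⁺ʳ; ∈-cartesianProduct⁺; ∈-filter⁺; ∈-filter⁻;
         ∈-concatMap⁺; ∈-concatMap⁻; ∈-deduplicate⁺; ∈-deduplicate⁻; ∈-lookup)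
open import Data.List.Membership.Propositional.Properties.WithK using (unique∧set⇒bag)
import Data.List.Properties as List
open import Data.List.Relation.Binary.BagAndSetEquality using (∼bag⇒↭)
import Data.List.Relation.Binary.Permutation.Homogeneous as Homogeneous
open import Data.List.Relation.Binary.Permutation.Propositional as ↭ using (_↭_; ↭⇒↭ₛ′)
import Data.List.Relation.Binary.Permutation.Propositional.Properties as ↭
open import Data.List.Relation.Binary.Pointwise as Pointwise using (Pointwise; []; _∷_)
open import Data.List.Relation.Unary.All as All using (All; []; _∷_)
open import Data.List.Relation.Unary.AllPairs using (_∷_)
open import Data.List.Relation.Unary.Any using (Any; here; there; index)
open import Data.List.Relation.Unary.Any.Properties using (lookup-index)
open import Data.List.Relation.Unary.Unique.DecPropositional.Properties using (deduplicate-!)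
open import Data.List.Relation.Unary.Unique.Propositional using (Unique)
import Data.List.Relation.Unary.Unique.Propositional.Properties as Unique
open import Data.Nat
  using (ℕ; zero; suc; _+_; _*_; _^_; _!; _≤_; _<_; z≤n; s≤s; s≤s⁻¹; NonZero; ≢-nonZero)
  renaming (_≟_ to _≟ᴺ_)
open import Data.Nat.Divisibility using (_∣_; quotient; ∣-trans; m∣m*n; n∣m*n; m≤n⇒m!∣n!)
open import Data.Nat.ListAction using () renaming (sum to sumˡ)
open import Data.Nat.ListAction.Properties using (sum-↭)
open import Data.Nat.Properties
  using (+-*-semiring; +-assoc; +-identityʳ; +-cancelˡ-≡; +-mono-≤; +-mono-≤-<;
         *-assoc; *-comm; *-identityˡ; *-identityʳ; *-zeroʳ; *-cancelʳ-≡; m*n≢0; _!≢0;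
         ≤-refl; ≤-reflexive; <-≤-trans; m≤n⇒m≤1+n; n≮0)
open import Algebra.Properties.Semiring.Sum +-*-semiring
open import Data.Product using (Σ; ∃; ∃-syntax; _×_; _,_; proj₁; proj₂)
import Data.Product.Properties as Product
open import Data.Product.Relation.Binary.Pointwise.NonDependent using (_×ₛ_)
open import Data.Sum using (_⊎_; inj₁; inj₂)
open import Data.Unit using (⊤; tt)
open import Data.Vec
  using (Vec; []; _∷_; lookup; tabulate; map; replicate; transpose; _⊛_; _++_)
open import Data.Vec.Functional using (Vector)
import Data.Vec.Membership.DecPropositional as DecMembership
open import Data.Vec.Membership.Propositional using () renaming (_∈_ to _∈ᵛ_)
import Data.Vec.Membership.Propositional.Properties as ∈ᵛ
import Data.Vec.Properties as Vec
open import Data.Vec.Properties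
  using (tabulate-cong; tabulate∘lookup; lookup∘tabulate; lookup-map; lookup-⊛;
         lookup-replicate; map-∘; map-cong; map-id)
import Data.Vec.Relation.Unary.Any as Anyᵛ
open import Function using (_∘_; case_of_; Injective)
open import Function.Bundles using (_⇔_; mk⇔)
open import Level using (0ℓ)
open import Relation.Binary using (IsEquivalence; Setoid; Transitive; DecidableEquality)
open import Relation.Binary.PropositionalEquality
  using (_≡_; _≢_; _≗_; refl; sym; trans; cong; cong₂; cong-app; subst; setoid; module ≡-Reasoning)
open import Relation.Nullary using (Dec; yes; no; does; ¬_; _×-dec_; contradiction)
open import Relation.Nullary.Decidable using (dec-true; does-⇔)
open import Relation.Unary using (Decidable)

-- Indicators of decidable propositions and finite sums

module _ {p} {P : Set p} where

  𝟙 : Dec P → ℕ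
  𝟙 (yes _) = 1
  𝟙 (no  _) = 0

  𝟙-true : (P? : Dec P) → P → 𝟙 P? ≡ 1
  𝟙-true (yes _) _ = refl
  𝟙-true (no ¬p) p = contradiction p ¬p

  𝟙-false : (P? : Dec P) → ¬ P → 𝟙 P? ≡ 0
  𝟙-false (yes p) ¬p = contradiction p ¬p
  𝟙-false (no _)  _  = refl

  𝟙≢0⇒true : (P? : Dec P) → 𝟙 P? ≢ 0 → P
  𝟙≢0⇒true (yes p) _   = p
  𝟙≢0⇒true (no _)  0≢0 = contradiction refl 0≢0

  𝟙≤1 : (P? : Dec P) → 𝟙 P? ≤ 1
  𝟙≤1 (yes _) = ≤-refl
  𝟙≤1 (no _)  = z≤n

𝟙-cong : ∀ {p q} {P : Set p} {Q : Set q} (P? : Dec P) (Q? : Dec Q) →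
         (P → Q) → (Q → P) → 𝟙 P? ≡ 𝟙 Q?
𝟙-cong (yes p) Q? P⇒Q Q⇒P = sym (𝟙-true Q? (P⇒Q p))
𝟙-cong (no ¬p) Q? P⇒Q Q⇒P = sym (𝟙-false Q? (¬p ∘ Q⇒P))

𝟙-*-cong : ∀ {P : Set} (P? : Dec P) {a b} → (P → a ≡ b) → 𝟙 P? * a ≡ 𝟙 P? * b
𝟙-*-cong (yes p) a≡b = cong (1 *_) (a≡b p)
𝟙-*-cong (no _)  _   = refl

∑≢0⇒∃≢0 : ∀ {n} (h : Vector ℕ n) → sum h ≢ 0 → ∃[ i ] h i ≢ 0
∑≢0⇒∃≢0 {zero}  h ∑≢0 = contradiction refl ∑≢0
∑≢0⇒∃≢0 {suc n} h ∑≢0 with h zero in h₀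
... | suc _ = zero , λ h₀≡0 → case trans (sym h₀) h₀≡0 of λ ()
... | zero  = let i , hᵢ≢0 = ∑≢0⇒∃≢0 (h ∘ suc) ∑≢0 in suc i , hᵢ≢0

∑-zero : ∀ {n} (h : Vector ℕ n) → (∀ i → h i ≡ 0) → sum h ≡ 0
∑-zero {n} h h≡0 = trans (sum-cong-≗ h≡0) (sum-replicate-zero n)

∑-single : ∀ {n} (h : Vector ℕ n) k → (∀ i → i ≢ k → h i ≡ 0) → sum h ≡ h k
∑-single h zero h≡0 =
  trans (cong (h zero +_) (∑-zero (h ∘ suc) λ i → h≡0 (suc i) λ ())) (+-identityʳ _)
∑-single h (suc k) h≡0
  rewrite h≡0 zero λ () = ∑-single (h ∘ suc) k λ i i≢k → h≡0 (suc i) λ { refl → i≢k refl }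

∑≡0⇒≡0 : ∀ {n} (h : Vector ℕ n) → sum h ≡ 0 → ∀ i → h i ≡ 0
∑≡0⇒≡0 {suc n} h ∑≡0 i with h zero in h₀ | ∑≡0
∑≡0⇒≡0 h ∑≡0 zero    | zero | _    = h₀
∑≡0⇒≡0 h ∑≡0 (suc i) | zero | ∑′≡0 = ∑≡0⇒≡0 (h ∘ suc) ∑′≡0 i

∑-≤ : ∀ {n} (h : Vector ℕ n) → (∀ i → h i ≤ 1) → sum h ≤ n
∑-≤ {zero}  h h≤1 = z≤n
∑-≤ {suc n} h h≤1 = +-mono-≤ (h≤1 zero) (∑-≤ (h ∘ suc) (h≤1 ∘ suc))

-- Operations depending only on multiplicities

count : ∀ {d n} → Fin d → Vector (Fin d) n → ℕ
count a xs = sum λ i → 𝟙 (xs i ≟ a)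

-- Induction on the length: the head of `ys` occurs in `xs` at some `k`; deleting both keeps all
-- counts equal, and `insert zero k` extends the permutation of the rest.
count-equal⇒permutation :
  ∀ {d n} (xs ys : Vector (Fin d) n) → (∀ a → count a xs ≡ count a ys) →
  ∃[ σ ] ∀ i → ys i ≡ xs (σ ⟨$⟩ʳ i)
count-equal⇒permutation {n = zero} xs ys eq = Perm.id , λ ()
count-equal⇒permutation {n = suc n} xs ys eq = insert zero k σ , agrees
  where
  y₀-occurs : count (ys zero) xs ≢ 0
  y₀-occurs c≡0 rewrite eq (ys zero) | 𝟙-true (ys zero ≟ ys zero) refl = case c≡0 of λ ()

  occurrence : ∃[ i ] 𝟙 (xs i ≟ ys zero) ≢ 0
  occurrence = ∑≢0⇒∃≢0 _ y₀-occurs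

  k : Fin (suc n)
  k = proj₁ occurrence

  xₖ≡y₀ : xs k ≡ ys zero
  xₖ≡y₀ = 𝟙≢0⇒true (xs k ≟ ys zero) (proj₂ occurrence)

  eq′ : ∀ a → count a (xs ∘ punchIn k) ≡ count a (ys ∘ suc)
  eq′ a = +-cancelˡ-≡ (𝟙 (xs k ≟ a)) _ _ (begin
    𝟙 (xs k ≟ a) + count a (xs ∘ punchIn k)  ≡⟨ sum-remove {i = k} (λ i → 𝟙 (xs i ≟ a)) ⟨
    count a xs                               ≡⟨ eq a ⟩
    𝟙 (ys zero ≟ a) + count a (ys ∘ suc)     ≡⟨ cong (λ y → 𝟙 (y ≟ a) + count a (ys ∘ suc)) xₖ≡y₀ ⟨
    𝟙 (xs k ≟ a) + count a (ys ∘ suc)        ∎)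
    where open ≡-Reasoning

  ih = count-equal⇒permutation (xs ∘ punchIn k) (ys ∘ suc) eq′
  σ = proj₁ ih

  agrees : ∀ i → ys i ≡ xs (insert zero k σ ⟨$⟩ʳ i)
  agrees zero    = sym xₖ≡y₀
  agrees (suc i) = trans (proj₂ ih i) (cong xs (sym (insert-punchIn zero k σ i)))

-- Reduces later comparisons of values of `f` to identities between sums.
symmetric-count : ∀ {d ℓ} {f : Operation d ℓ} → Symmetric f → (xs ys : Vec (Fin d) ℓ) →
                  (∀ a → count a (lookup xs) ≡ count a (lookup ys)) → f xs ≡ f ys
symmetric-count {f = f} f-sym xs ys eq = trans (f-sym xs σ)
  (cong f (trans (tabulate-cong (sym ∘ ys≗xs∘σ)) (tabulate∘lookup ys)))
  where
  perm = count-equal⇒permutation (lookup xs) (lookup ys) eq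
  σ = proj₁ perm
  ys≗xs∘σ = proj₂ perm

-- Vectors with prescribed multiplicities

∑-replicate : ∀ {A : Set} (h : A → ℕ) w x → sum (h ∘ lookup (replicate w x)) ≡ w * h x
∑-replicate h zero    x = refl
∑-replicate h (suc w) x = cong (h x +_) (∑-replicate h w x)

∑-++ : ∀ {A : Set} (h : A → ℕ) {k l} (xs : Vec A k) (ys : Vec A l) →
       sum (h ∘ lookup (xs ++ ys)) ≡ sum (h ∘ lookup xs) + sum (h ∘ lookup ys)
∑-++ h []       ys = refl
∑-++ h (x ∷ xs) ys = trans (cong (h x +_) (∑-++ h xs ys)) (sym (+-assoc (h x) _ _))

∑-map : ∀ {A B : Set} (g : A → B) (h : B → ℕ) {k} (xs : Vec A k) →
        sum (h ∘ lookup (map g xs)) ≡ sum (h ∘ g ∘ lookup xs)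
∑-map g h []       = refl
∑-map g h (x ∷ xs) = cong (h (g x) +_) (∑-map g h xs)

-- The witness lists each `i` in a block of length `w i`. Testing it against all `h` records the
-- multiset of its entries without reference to positions.
spread : ∀ {n} (w : Vector ℕ n) →
         ∃[ v ] ∀ h → sum (h ∘ lookup {n = sum w} v) ≡ sum (λ i → w i * h i)
spread {zero}  w = [] , λ h → refl
spread {suc n} w = let v , v-spreads = spread (w ∘ suc) in
  replicate (w zero) zero ++ map suc v , λ h → begin
    sum (h ∘ lookup (replicate (w zero) zero ++ map suc v))
      ≡⟨ ∑-++ h (replicate (w zero) zero) (map suc v) ⟩
    sum (h ∘ lookup (replicate (w zero) zero)) + sum (h ∘ lookup (map suc v))
      ≡⟨ cong₂ _+_ (∑-replicate h (w zero) zero) (trans (∑-map suc h v) (v-spreads (h ∘ suc))) ⟩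
    w zero * h zero + sum (λ i → w (suc i) * h (suc i)) ∎
  where open ≡-Reasoning

-- Blocks of length `q * w i` give total length `sum (λ i → q * w i)`, which is `L` only by
-- distributivity; hence the transport.
weighted-vector : ∀ {n L} q (w : Vector ℕ n) → q * sum w ≡ L →
  ∃[ v ] ∀ h → sum (h ∘ lookup {n = L} v) ≡ q * sum (λ i → w i * h i)
weighted-vector q w refl = subst
  (λ L → ∃[ v ] ∀ h → sum (h ∘ lookup {n = L} v) ≡ q * sum (λ i → w i * h i))
  (sym (*-distribˡ-sum q w))
  (let v , v-spreads = spread (λ i → q * w i) in v , λ h → begin
    sum (h ∘ lookup v)                ≡⟨ v-spreads h ⟩
    sum (λ i → q * w i * h i)         ≡⟨ sum-cong-≗ (λ i → *-assoc q (w i) (h i)) ⟩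
    sum (λ i → q * (w i * h i))       ≡⟨ *-distribˡ-sum q (λ i → w i * h i) ⟨
    q * sum (λ i → w i * h i)         ∎)
  where open ≡-Reasoning

-- Extensionality and transposition of vectors

lookup-ext : ∀ {A : Set} {k} (xs ys : Vec A k) → (∀ i → lookup xs i ≡ lookup ys i) → xs ≡ ys
lookup-ext xs ys eq = trans (sym (tabulate∘lookup xs)) (trans (tabulate-cong eq) (tabulate∘lookup ys))

lookup-transpose-∷ : ∀ {A : Set} {k l} (xs : Vec A k) (xss : Vec (Vec A k) l) i →
                     lookup (transpose (xs ∷ xss)) i ≡ lookup xs i ∷ lookup (transpose xss) i
lookup-transpose-∷ {A} {k} {l} xs xss i = begin
  lookup (conses ⊛ xs ⊛ transpose xss) i                  ≡⟨ lookup-⊛ i (conses ⊛ xs) (transpose xss) ⟩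
  lookup (conses ⊛ xs) i (lookup (transpose xss) i)       ≡⟨ cong-app (lookup-⊛ i conses xs) _ ⟩
  lookup conses i (lookup xs i) (lookup (transpose xss) i)
    ≡⟨ cong (λ (g : A → Vec A l → Vec A (suc l)) → g (lookup xs i) (lookup (transpose xss) i))
            (lookup-replicate i _∷_) ⟩
  lookup xs i ∷ lookup (transpose xss) i                  ∎
  where
  open ≡-Reasoning
  conses : Vec (A → Vec A l → Vec A (suc l)) k
  conses = replicate k _∷_

lookup-transpose : ∀ {A : Set} {k l} (xss : Vec (Vec A k) l) i j →
                   lookup (lookup (transpose xss) i) j ≡ lookup (lookup xss j) i
lookup-transpose (xs ∷ xss) i zero    = cong (λ v → lookup v zero) (lookup-transpose-∷ xs xss i)
lookup-transpose (xs ∷ xss) i (suc j) =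
  trans (cong (λ v → lookup v (suc j)) (lookup-transpose-∷ xs xss i)) (lookup-transpose xss i j)

-- Permutations up to a relation

module _ {A : Set} {R : A → A → Set} (R-trans : Transitive R) where

  -- Each rearrangement of `ys` can be carried out on `xs` beforehand, the entrywise relations
  -- moving along.
  pointwise-↭ : ∀ {xs ys zs} → Pointwise R xs ys → ys ↭ zs →
                ∃[ ws ] (xs ↭ ws × Pointwise R ws zs)
  pointwise-↭ p ↭.refl = _ , ↭.refl , p
  pointwise-↭ (r ∷ p) (↭.prep _ q) =
    let _ , q′ , p′ = pointwise-↭ p q in _ , ↭.prep _ q′ , r ∷ p′
  pointwise-↭ (r ∷ s ∷ p) (↭.swap _ _ q) =
    let _ , q′ , p′ = pointwise-↭ p q in _ , ↭.swap _ _ q′ , s ∷ r ∷ p′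
  pointwise-↭ p (↭.trans q₁ q₂) =
    let _ , q₁′ , p₁ = pointwise-↭ p q₁
        _ , q₂′ , p₂ = pointwise-↭ p₁ q₂
    in _ , ↭.trans q₁′ q₂′ , p₂

  -- All rearrangements are moved before all uses of `R`: at a transitive step `pointwise-↭`
  -- exchanges the middle two, and transitivity of `R` merges the rest.
  ↭-factor : ∀ {xs ys} → Homogeneous.Permutation R xs ys →
             ∃[ ws ] (xs ↭ ws × Pointwise R ws ys)
  ↭-factor (Homogeneous.refl p) = _ , ↭.refl , p
  ↭-factor (Homogeneous.prep r q) =
    let _ , q′ , p = ↭-factor q in _ , ↭.prep _ q′ , r ∷ p
  ↭-factor (Homogeneous.swap r s q) =
    let _ , q′ , p = ↭-factor q in _ , ↭.swap _ _ q′ , s ∷ r ∷ p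
  ↭-factor (Homogeneous.trans q₁ q₂) =
    let _ , q₁′ , p₁ = ↭-factor q₁
        _ , q₂′ , p₂ = ↭-factor q₂
        _ , q₃  , p₃ = pointwise-↭ p₁ q₂′
    in _ , ↭.trans q₁′ q₃ , Pointwise.transitive R-trans p₃ p₂

-- Sums over lists

∑ˡ : ∀ {A : Set} → (A → ℕ) → List A → ℕ
∑ˡ h xs = sumˡ (List.map h xs)

module _ {A B C : Set} {R : C → C → Set} (R-trans : Transitive R) where

  -- After factoring, the rearrangement of `List.map f xs` lifts to one of `xs`, which leaves the
  -- sum unchanged; what remains is compared entry by entry.
  ∑ˡ-↭ : (f : A → C) (g : B → C) (p : A → ℕ) (q : B → ℕ) →
         (∀ x y → R (f x) (g y) → p x ≡ q y) →
         ∀ {xs ys} → Homogeneous.Permutation R (List.map f xs) (List.map g ys) →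
         ∑ˡ p xs ≡ ∑ˡ q ys
  ∑ˡ-↭ f g p q p≡q f[xs]↭g[ys] with ↭-factor R-trans f[xs]↭g[ys]
  ... | _ , f[xs]↭ws , ws~g[ys] with ↭.↭-map-inv f f[xs]↭ws
  ... | xs′ , refl , xs↭xs′ =
    trans (sum-↭ (↭.map⁺ p xs↭xs′)) (aligned xs′ _ ws~g[ys])
    where
    aligned : ∀ xs ys → Pointwise R (List.map f xs) (List.map g ys) → ∑ˡ p xs ≡ ∑ˡ q ys
    aligned []       []       []       = refl
    aligned (x ∷ xs) (y ∷ ys) (r ∷ rs) = cong₂ _+_ (p≡q x y r) (aligned xs ys rs)

∑ˡ-filter : ∀ {A : Set} {P : A → Set} (P? : Decidable P) (h : A → ℕ) →
            (∀ x → ¬ P x → h x ≡ 0) → ∀ xs → ∑ˡ h (List.filter P? xs) ≡ ∑ˡ h xs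
∑ˡ-filter P? h h≡0 []       = refl
∑ˡ-filter P? h h≡0 (x ∷ xs) with P? x
... | yes _ = cong (h x +_) (∑ˡ-filter P? h h≡0 xs)
... | no ¬p = trans (∑ˡ-filter P? h h≡0 xs) (cong (_+ ∑ˡ h xs) (sym (h≡0 x ¬p)))

∑ˡ-tabulate : ∀ {A : Set} {n} (h : A → ℕ) (g : Fin n → A) → ∑ˡ h (List.tabulate g) ≡ sum (h ∘ g)
∑ˡ-tabulate {n = zero}  h g = refl
∑ˡ-tabulate {n = suc n} h g = cong (h (g zero) +_) (∑ˡ-tabulate h (g ∘ suc))

-- Stabilisation of decreasing sequences

module _ {A : Set} {P Q : A → Set} (P? : Decidable P) (Q? : Decidable Q)
         (Q⊆P : ∀ {x} → Q x → P x) where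

  𝟙-mono : ∀ x → 𝟙 (Q? x) ≤ 𝟙 (P? x)
  𝟙-mono x with Q? x
  ... | yes q = ≤-reflexive (sym (𝟙-true (P? x) (Q⊆P q)))
  ... | no _  = z≤n

  ∑ˡ-mono : ∀ xs → ∑ˡ (𝟙 ∘ Q?) xs ≤ ∑ˡ (𝟙 ∘ P?) xs
  ∑ˡ-mono []       = z≤n
  ∑ˡ-mono (x ∷ xs) = +-mono-≤ (𝟙-mono x) (∑ˡ-mono xs)

  equal-or-smaller : ∀ xs → All (λ x → P x → Q x) xs ⊎ ∑ˡ (𝟙 ∘ Q?) xs < ∑ˡ (𝟙 ∘ P?) xs
  equal-or-smaller []       = inj₁ []
  equal-or-smaller (x ∷ xs) with equal-or-smaller xs
  ... | inj₂ lt  = inj₂ (+-mono-≤-< (𝟙-mono x) lt)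
  ... | inj₁ P⇒Q with P? x | Q? x
  ...   | _     | yes q = inj₁ ((λ _ → q) ∷ P⇒Q)
  ...   | no ¬p | no _  = inj₁ ((λ p → contradiction p ¬p) ∷ P⇒Q)
  ...   | yes _ | no _  = inj₂ (s≤s (∑ˡ-mono xs))

module _ {A : Set} {P : ℕ → A → Set} (P? : ∀ r → Decidable (P r))
         (decreasing : ∀ {r x} → P (suc r) x → P r x) (xs : List A) where

  -- The number of entries of `xs` satisfying `P r` drops strictly in every round that is not
  -- stable, so the initial number bounds the search.
  stabilises : ∃[ r ] All (λ x → P r x → P (suc r) x) xs
  stabilises = search _ 0 ≤-refl
    where
    search : ∀ fuel r → ∑ˡ (𝟙 ∘ P? r) xs ≤ fuel → ∃[ r ] All (λ x → P r x → P (suc r) x) xs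
    search fuel r bound with equal-or-smaller (P? r) (P? (suc r)) decreasing xs
    search fuel       r bound | inj₁ stable  = r , stable
    search zero       r bound | inj₂ smaller = contradiction (<-≤-trans smaller bound) n≮0
    search (suc fuel) r bound | inj₂ smaller = search fuel (suc r) (s≤s⁻¹ (<-≤-trans smaller bound))

-- Colour refinement

_≟ᴿ_ : ∀ {d} → DecidableEquality (Relation d)
mkRelation k T ≟ᴿ mkRelation k′ T′ with k ≟ᴺ k′
... | no k≢k′ = no λ { refl → k≢k′ refl }
... | yes refl with Vec.≡-dec Bool._≟_ T T′
...   | no T≢T′  = no λ { refl → T≢T′ refl }
...   | yes refl = yes refl

_≟ᴸ_ : ∀ {d} → DecidableEquality (Label d)
_≟ᴸ_ = Product.≡-dec _≟ᴿ_ (Vec.≡-dec Bool._≟_)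

-- Edge labels and alignment of scopes

labelOf : ∀ {d n} → Fin n → Constraint d n → Label d
labelOf x c = rel c , map (λ y → does (y ≟ x)) (scope c)

module _ {d n : ℕ} where

  Label-≡⁻ : {p q : Label d} → p ≡ q →
             Σ (proj₁ p ≡ proj₁ q) λ e → subst (λ R → Subset (arity R)) e (proj₂ p) ≡ proj₂ q
  Label-≡⁻ refl = refl , refl

  -- Position `i` belongs to the positions of `lookup s i` in `s`, hence to those of `x` in `s′`.
  same-position : ∀ {k} (s s′ : Vec (Fin n) k) i {x} →
                  map (λ y → does (y ≟ x)) s′ ≡ map (λ y → does (y ≟ lookup s i)) s →
                  lookup s′ i ≡ x
  same-position s s′ i {x} eq = does≡true⇒ (lookup s′ i ≟ x) (begin
    does (lookup s′ i ≟ x)                              ≡⟨ lookup-map i _ s′ ⟨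
    lookup (map (λ y → does (y ≟ x)) s′) i              ≡⟨ cong (λ v → lookup v i) eq ⟩
    lookup (map (λ y → does (y ≟ lookup s i)) s) i      ≡⟨ lookup-map i _ s ⟩
    does (lookup s i ≟ lookup s i)                      ≡⟨ dec-true (lookup s i ≟ lookup s i) refl ⟩
    true                                                ∎)
    where
    open ≡-Reasoning
    does≡true⇒ : ∀ {P : Set} (P? : Dec P) → does P? ≡ true → P
    does≡true⇒ (yes p) _ = p

  -- Labels are also defined outside the scope, with empty position set. A label taken from a
  -- position is nonempty, so equality with it forces incidence.
  same-label⇒∈ : ∀ (c c′ : Constraint d n) i {x} →
                 labelOf x c′ ≡ labelOf (lookup (scope c) i) c → x ∈ᵛ scope c′
  same-label⇒∈ (mkConstraint R s) (mkConstraint R′ s′) i eq with Label-≡⁻ eq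
  ... | refl , eq′ with same-position s s′ i eq′
  ...   | refl = ∈ᵛ.∈-lookup i s′

  -- Meaningful only if rel c′ ≡ rel c; otherwise the junk value is scope c, so that
  -- every solution still satisfies the result.
  align : (c c′ : Constraint d n) → Vec (Fin n) (arity (rel c))
  align c c′ with rel c′ ≟ᴿ rel c
  ... | yes e = subst (λ R → Vec (Fin n) (arity R)) e (scope c′)
  ... | no _  = scope c

  -- Consequently at most one variable of `c′` carries the label of a given position of `c`.
  align-lookup : ∀ (c c′ : Constraint d n) i {x} →
                 labelOf x c′ ≡ labelOf (lookup (scope c) i) c → lookup (align c c′) i ≡ x
  align-lookup (mkConstraint R s) (mkConstraint R′ s′) i eq with R′ ≟ᴿ R | Label-≡⁻ eq
  ... | yes refl | refl , eq′ = same-position s s′ i eq′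
  ... | no R′≢R  | e , _      = contradiction e R′≢R

  align-satisfied : ∀ {ν : Fin n → Fin d} (c c′ : Constraint d n) →
                    map ν (scope c) ∈ᴿ tuples (rel c) → map ν (scope c′) ∈ᴿ tuples (rel c′) →
                    map ν (align c c′) ∈ᴿ tuples (rel c)
  align-satisfied (mkConstraint R s) (mkConstraint R′ s′) sat sat′ with R′ ≟ᴿ R
  ... | yes refl = sat′
  ... | no _     = sat

-- Counting neighbours by means of iterated degrees

module _ {d N : ℕ} (S : Setoid 0ℓ 0ℓ) (D : Fin N → Setoid.Carrier S)
         {E : Fin N → Set} (E? : Decidable E)
         (E-resp : ∀ {a b} → Setoid._≈_ S (D a) (D b) → E a → E b)
         (l : Label d) where

  open Setoid S using () renaming (sym to ≈-sym)
  open Setoid (setoid (Label d) ×ₛ S) using () renaming (_≈_ to _≈ˢ_; trans to ≈ˢ-trans)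

  neighbour-count : (Fin N → Label d) → ℕ
  neighbour-count f = sum λ a → 𝟙 (f a ≟ᴸ l) * 𝟙 (E? a)

  ∑ˡ-neighbours : ∀ {P : Fin N → Set} (P? : Decidable P) f → (∀ a → f a ≡ l → P a) →
                  ∑ˡ (λ a → 𝟙 (f a ≟ᴸ l) * 𝟙 (E? a)) (List.filter P? (List.allFin N)) ≡ neighbour-count f
  ∑ˡ-neighbours P? f P-holds = trans
    (∑ˡ-filter P? h (λ a ¬p → cong (_* 𝟙 (E? a)) (𝟙-false (f a ≟ᴸ l) (¬p ∘ P-holds a))) (List.allFin N))
    (∑ˡ-tabulate h (λ a → a))
    where h = λ a → 𝟙 (f a ≟ᴸ l) * 𝟙 (E? a)

  -- The multiset determines how many neighbours have label `l` and lie in `E`, because `E` respects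
  -- equality of degrees. As label `l` occurs at neighbours only, the sum may run over all nodes.
  neighbour-count-≡ :
    ∀ {P Q : Fin N → Set} (P? : Decidable P) (Q? : Decidable Q) f g →
    (∀ a → f a ≡ l → P a) → (∀ a → g a ≡ l → Q a) →
    Homogeneous.Permutation _≈ˢ_
      (List.map (λ a → f a , D a) (List.filter P? (List.allFin N)))
      (List.map (λ a → g a , D a) (List.filter Q? (List.allFin N))) →
    neighbour-count f ≡ neighbour-count g
  neighbour-count-≡ P? Q? f g P-holds Q-holds perm = begin
    neighbour-count f
      ≡⟨ ∑ˡ-neighbours P? f P-holds ⟨
    ∑ˡ (λ a → 𝟙 (f a ≟ᴸ l) * 𝟙 (E? a)) (List.filter P? (List.allFin N))
      ≡⟨ ∑ˡ-↭ {R = _≈ˢ_} ≈ˢ-trans _ _ _ _ (λ a b (fa≡gb , Da≈Db) → cong₂ _*_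
           (𝟙-cong (f a ≟ᴸ l) (g b ≟ᴸ l) (trans (sym fa≡gb)) (trans fa≡gb))
           (𝟙-cong (E? a) (E? b) (E-resp Da≈Db) (E-resp (≈-sym Da≈Db))))
           perm ⟩
    ∑ˡ (λ a → 𝟙 (g a ≟ᴸ l) * 𝟙 (E? a)) (List.filter Q? (List.allFin N))
      ≡⟨ ∑ˡ-neighbours Q? g Q-holds ⟩
    neighbour-count g ∎
    where open ≡-Reasoning

-- The refinement sequence

module Refinement {d : ℕ} (I : Instance d) where
  open Instance I public
  open FactorGraph I public
  open DecMembership (_≟_ {n}) using (_∈?_)

  m : ℕ
  m = List.length constraints

  Position : Fin m → Set
  Position j = Fin (arity (rel (constraint j)))

  variableAt : ∀ j → Position j → Fin n
  variableAt j = lookup (scope (constraint j))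

  labelAt : ∀ j → Position j → Label d
  labelAt j i = label (variableAt j i) j

  -- Equal k-th iterated degrees with k ≥ r imply V r and C r, which unlike these
  -- are decidable, and decreasing in r by construction.
  V : ℕ → Fin n → Fin n → Set
  C : ℕ → Fin m → Fin m → Set
  V? : ∀ r x x′ → Dec (V r x x′)
  C? : ∀ r j j′ → Dec (C r j j′)

  -- Only labels that occur in I are counted, each given by a constraint j and a
  -- position i in it: this makes equality of all these degrees decidable.
  degreeᵛ : ℕ → Fin n → ∀ j → Position j → ℕ
  degreeᵛ r x j i = sum λ j′ → 𝟙 (label x j′ ≟ᴸ labelAt j i) * 𝟙 (C? r j j′)

  degreeᶜ : ℕ → Fin m → ∀ j → Position j → ℕ
  degreeᶜ r j′ j i = sum λ x → 𝟙 (label x j′ ≟ᴸ labelAt j i) * 𝟙 (V? r (variableAt j i) x)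

  V zero    x x′ = ⊤
  V (suc r) x x′ = V r x x′ × (∀ j i → degreeᵛ r x j i ≡ degreeᵛ r x′ j i)

  C zero    j j′ = ⊤
  C (suc r) j j′ = C r j j′ × (∀ j₀ i → degreeᶜ r j j₀ i ≡ degreeᶜ r j′ j₀ i)

  V? zero    x x′ = yes tt
  V? (suc r) x x′ = V? r x x′ ×-dec all? λ j → all? λ i → degreeᵛ r x j i ≟ᴺ degreeᵛ r x′ j i

  C? zero    j j′ = yes tt
  C? (suc r) j j′ = C? r j j′ ×-dec all? λ j₀ → all? λ i → degreeᶜ r j j₀ i ≟ᴺ degreeᶜ r j′ j₀ i

  V-isEquivalence : ∀ r → IsEquivalence (V r)
  V-isEquivalence zero    = record { refl = tt ; sym = λ _ → tt ; trans = λ _ _ → tt }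
  V-isEquivalence (suc r) = record
    { refl  = E.refl , λ j i → refl
    ; sym   = λ (v , eq) → E.sym v , λ j i → sym (eq j i)
    ; trans = λ (v , eq) (w , eq′) → E.trans v w , λ j i → trans (eq j i) (eq′ j i)
    } where module E = IsEquivalence (V-isEquivalence r)

  C-isEquivalence : ∀ r → IsEquivalence (C r)
  C-isEquivalence zero    = record { refl = tt ; sym = λ _ → tt ; trans = λ _ _ → tt }
  C-isEquivalence (suc r) = record
    { refl  = E.refl , λ j i → refl
    ; sym   = λ (v , eq) → E.sym v , λ j i → sym (eq j i)
    ; trans = λ (v , eq) (w , eq′) → E.trans v w , λ j i → trans (eq j i) (eq′ j i)
    } where module E = IsEquivalence (C-isEquivalence r)

  module Vᵉ r = IsEquivalence (V-isEquivalence r)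
  module Cᵉ r = IsEquivalence (C-isEquivalence r)

  -- Simultaneous induction. Allowing every `k ≥ r` yields the component `V r` of `V (suc r)` from
  -- the same degree, without comparing degrees of different depths.
  δ-refines-V : ∀ r k → r ≤ k → ∀ {x x′} →
                Setoid._≈_ (Degree d k) (δ k (inj₁ x)) (δ k (inj₁ x′)) → V r x x′
  δ-refines-C : ∀ r k → r ≤ k → ∀ {j j′} →
                Setoid._≈_ (Degree d k) (δ k (inj₂ j)) (δ k (inj₂ j′)) → C r j j′
  δ-refines-V zero    k       _         _ = tt
  δ-refines-V (suc r) (suc k) (s≤s r≤k) {x} {x′} δ≈ =
    δ-refines-V r (suc k) (m≤n⇒m≤1+n r≤k) δ≈ , λ j i →
    neighbour-count-≡ (Degree d k) (λ j → δ k (inj₂ j)) (C? r j)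
      -- The constraints counted form the class of `j`; by induction, equal degrees keep a
      -- constraint in this class.
      (λ a~b c → Cᵉ.trans r c (δ-refines-C r k r≤k a~b)) (labelAt j i)
      (λ j′ → x ∈? scope (constraint j′)) (λ j′ → x′ ∈? scope (constraint j′)) (label x) (label x′)
      (λ j′ → same-label⇒∈ (constraint j) (constraint j′) i)
      (λ j′ → same-label⇒∈ (constraint j) (constraint j′) i) δ≈
  δ-refines-C zero    k       _         _ = tt
  δ-refines-C (suc r) (suc k) (s≤s r≤k) {j} {j′} δ≈ =
    δ-refines-C r (suc k) (m≤n⇒m≤1+n r≤k) δ≈ , λ j₀ i →
    neighbour-count-≡ (Degree d k) (λ x → δ k (inj₁ x)) (V? r (variableAt j₀ i))
      (λ a~b v → Vᵉ.trans r v (δ-refines-V r k r≤k a~b)) (labelAt j₀ i)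
      (λ x → x ∈? scope (constraint j)) (λ x → x ∈? scope (constraint j′))
      (λ x → label x j) (λ x → label x j′)
      (λ x → same-label⇒∈ (constraint j₀) (constraint j) i)
      (λ x → same-label⇒∈ (constraint j₀) (constraint j′) i) δ≈

  Stable : ℕ → Set
  Stable r = (∀ {x x′} → V r x x′ → V (suc r) x x′) × (∀ {j j′} → C r j j′ → C (suc r) j j′)

  -- Pairs of variables and pairs of constraints go into one list, so that both partitions are
  -- stable in the same round.
  eventually-stable : ∃ Stable
  eventually-stable = r , (λ {x} {x′} → V-stable x x′) , λ {j} {j′} → C-stable j j′
    where
    Related : ℕ → (Fin n × Fin n) ⊎ (Fin m × Fin m) → Set
    Related r (inj₁ (x , x′)) = V r x x′
    Related r (inj₂ (j , j′)) = C r j j′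

    Related? : ∀ r → Decidable (Related r)
    Related? r (inj₁ (x , x′)) = V? r x x′
    Related? r (inj₂ (j , j′)) = C? r j j′

    decreasing : ∀ {r} {p} → Related (suc r) p → Related r p
    decreasing {p = inj₁ _} = proj₁
    decreasing {p = inj₂ _} = proj₁

    pairs : ∀ N → List (Fin N × Fin N)
    pairs N = List.cartesianProduct (List.allFin N) (List.allFin N)

    ∈-pairs : ∀ {N} (a b : Fin N) → (a , b) ∈ pairs N
    ∈-pairs a b = ∈-cartesianProduct⁺ (∈-allFin a) (∈-allFin b)

    stabilisation = stabilises Related? (λ {r} {p} → decreasing {r} {p})
                      (List.map inj₁ (pairs n) List.++ List.map inj₂ (pairs m))
    r = proj₁ stabilisation

    V-stable : ∀ x x′ → V r x x′ → V (suc r) x x′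
    V-stable x x′ = All.lookup (proj₂ stabilisation) (∈-++⁺ˡ (∈-map⁺ inj₁ (∈-pairs x x′)))

    C-stable : ∀ j j′ → C r j j′ → C (suc r) j j′
    C-stable j j′ = All.lookup (proj₂ stabilisation)
      (∈-++⁺ʳ (List.map inj₁ (pairs n)) (∈-map⁺ inj₂ (∈-pairs j j′)))

-- Makes a factorial a common multiple of all possible class sizes.
divides-! : ∀ {k N} → k ≢ 0 → k ≤ N → k ∣ N !
divides-! {zero}  k≢0 _   = contradiction refl k≢0
divides-! {suc k} _   k≤N = ∣-trans (m∣m*n (k !)) (m≤n⇒m!∣n! k≤N)

-- Double counting in a stable partition

module StableRefinement {d : ℕ} (I : Instance d) (r : ℕ) (stable : Refinement.Stable I r) where
  open Refinement I

  sizeᵛ : Fin n → ℕ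
  sizeᵛ x = sum λ y → 𝟙 (V? r x y)

  sizeᶜ : Fin m → ℕ
  sizeᶜ j = sum λ j′ → 𝟙 (C? r j j′)

  sizeᵛ≢0 : ∀ x → sizeᵛ x ≢ 0
  sizeᵛ≢0 x size≡0 with () ← trans (sym (𝟙-true (V? r x x) (Vᵉ.refl r))) (∑≡0⇒≡0 _ size≡0 x)

  sizeᶜ≢0 : ∀ j → sizeᶜ j ≢ 0
  sizeᶜ≢0 j size≡0 with () ← trans (sym (𝟙-true (C? r j j) (Cᵉ.refl r))) (∑≡0⇒≡0 _ size≡0 j)

  -- The variable of `j` at `i` itself contributes to `degreeᶜ r j j i`; stability carries the
  -- nonzero count over to `j′`, where any contributing variable is a witness.
  matching-variable : ∀ {j j′} → C r j j′ → ∀ i →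
                      ∃[ y ] (label y j′ ≡ labelAt j i × V r (variableAt j i) y)
  matching-variable {j} {j′} c i = y ,
    𝟙≢0⇒true (label y j′ ≟ᴸ labelAt j i) (λ l≡0 → y-counts (cong (_* 𝟙 (V? r x y)) l≡0)) ,
    𝟙≢0⇒true (V? r x y) (λ v≡0 → y-counts
      (trans (cong (𝟙 (label y j′ ≟ᴸ labelAt j i) *_) v≡0) (*-zeroʳ (𝟙 (label y j′ ≟ᴸ labelAt j i)))))
    where
    x = variableAt j i

    degree≢0 : degreeᶜ r j′ j i ≢ 0
    degree≢0 degree≡0 with () ← trans
      (sym (cong₂ _*_ (𝟙-true (label x j ≟ᴸ labelAt j i) refl) (𝟙-true (V? r x x) (Vᵉ.refl r))))
      (∑≡0⇒≡0 _ (trans (proj₂ (proj₂ stable c) j i) degree≡0) x)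

    occurrence = ∑≢0⇒∃≢0 _ degree≢0
    y = proj₁ occurrence
    y-counts = proj₂ occurrence

  entry : ∀ j → Position j → Fin m → Fin n
  entry j i j′ = lookup (align (constraint j) (constraint j′)) i

  -- By `align-lookup` no other variable has the same label in `j′`, so one summand survives. In
  -- this form the sums over constraints and variables can be exchanged.
  entry-∑ : ∀ {j j′} → C r j j′ → ∀ i (h : Fin n → ℕ) →
            h (entry j i j′) ≡ sum λ y → 𝟙 (V? r (variableAt j i) y) * (h y * 𝟙 (label y j′ ≟ᴸ labelAt j i))
  entry-∑ {j} {j′} c i h = begin
    h (entry j i j′)
      ≡⟨ cong h (align-lookup (constraint j) (constraint j′) i y-label) ⟩
    h y
      ≡⟨ trans (cong₂ (λ a b → a * (h y * b)) (𝟙-true (V? r x y) x~y) (𝟙-true (label y j′ ≟ᴸ l) y-label))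
               (trans (*-identityˡ _) (*-identityʳ (h y))) ⟨
    𝟙 (V? r x y) * (h y * 𝟙 (label y j′ ≟ᴸ l))
      ≡⟨ ∑-single _ y (λ y′ y′≢y → others y′ y′≢y) ⟨
    sum (λ y → 𝟙 (V? r x y) * (h y * 𝟙 (label y j′ ≟ᴸ l))) ∎
    where
    open ≡-Reasoning
    x = variableAt j i
    l = labelAt j i
    match = matching-variable c i
    y = proj₁ match
    y-label = proj₁ (proj₂ match)
    x~y = proj₂ (proj₂ match)

    others : ∀ y′ → y′ ≢ y → 𝟙 (V? r x y′) * (h y′ * 𝟙 (label y′ j′ ≟ᴸ l)) ≡ 0
    others y′ y′≢y
      rewrite 𝟙-false (label y′ j′ ≟ᴸ l) (λ y′-label → y′≢y (trans
                (sym (align-lookup (constraint j) (constraint j′) i y′-label))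
                (align-lookup (constraint j) (constraint j′) i y-label)))
            | *-zeroʳ (h y′)
      = *-zeroʳ (𝟙 (V? r x y′))

  -- Counts, with weight `h`, the pairs of a constraint in the class of `j` and a variable in the
  -- class of `variableAt j i` joined by the label `labelAt j i`: each constraint is in exactly one
  -- pair, and by stability all variables are in equally many.
  double-count : ∀ j i (h : Fin n → ℕ) →
    sum (λ j′ → 𝟙 (C? r j j′) * h (entry j i j′)) ≡
    degreeᵛ r (variableAt j i) j i * sum (λ y → 𝟙 (V? r (variableAt j i) y) * h y)
  double-count j i h = begin
    sum (λ j′ → c j′ * h (entry j i j′))
      ≡⟨ sum-cong-≗ (λ j′ → trans (𝟙-*-cong (C? r j j′) (λ c → entry-∑ c i h))
                                  (*-distribˡ-sum (c j′) (λ y → v y * (h y * l y j′)))) ⟩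
    sum (λ j′ → sum λ y → c j′ * (v y * (h y * l y j′)))
      ≡⟨ ∑-comm (λ j′ y → c j′ * (v y * (h y * l y j′))) ⟩
    sum (λ y → sum λ j′ → c j′ * (v y * (h y * l y j′)))
      ≡⟨ sum-cong-≗ (λ y → trans (sum-cong-≗ λ j′ → rearrange (c j′) (v y) (h y) (l y j′))
                                 (sym (*-distribˡ-sum (v y) (λ j′ → h y * (l y j′ * c j′))))) ⟩
    sum (λ y → v y * sum λ j′ → h y * (l y j′ * c j′))
      ≡⟨ sum-cong-≗ (λ y → 𝟙-*-cong (V? r x y) λ x~y → begin
           sum (λ j′ → h y * (l y j′ * c j′))  ≡⟨ *-distribˡ-sum (h y) (λ j′ → l y j′ * c j′) ⟨
           h y * degreeᵛ r y j i               ≡⟨ cong (h y *_) (proj₂ (proj₁ stable x~y) j i) ⟨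
           h y * μ                             ∎) ⟩
    sum (λ y → v y * (h y * μ))
      ≡⟨ sum-cong-≗ (λ y → *-assoc (v y) (h y) μ) ⟨
    sum (λ y → v y * h y * μ)
      ≡⟨ *-distribʳ-sum μ (λ y → v y * h y) ⟨
    sum (λ y → v y * h y) * μ
      ≡⟨ *-comm (sum λ y → v y * h y) μ ⟩
    μ * sum (λ y → v y * h y) ∎
    where
    open ≡-Reasoning
    x = variableAt j i
    μ = degreeᵛ r x j i
    c = λ j′ → 𝟙 (C? r j j′)
    v = λ y → 𝟙 (V? r x y)
    l = λ y j′ → 𝟙 (label y j′ ≟ᴸ labelAt j i)
    rearrange : ∀ c v h l → c * (v * (h * l)) ≡ v * (h * (l * c))
    rearrange c v h l = trans (*-comm c _) (trans (*-assoc v _ c) (cong (v *_) (*-assoc h l c)))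

  sizeᶜ-sizeᵛ : ∀ j i → sizeᶜ j ≡ degreeᵛ r (variableAt j i) j i * sizeᵛ (variableAt j i)
  sizeᶜ-sizeᵛ j i = begin
    sizeᶜ j                                     ≡⟨ sum-cong-≗ (λ j′ → *-identityʳ (𝟙 (C? r j j′))) ⟨
    sum (λ j′ → 𝟙 (C? r j j′) * 1)              ≡⟨ double-count j i (λ _ → 1) ⟩
    μ * sum (λ y → 𝟙 (V? r x y) * 1)
      ≡⟨ cong (μ *_) (sum-cong-≗ (λ y → *-identityʳ (𝟙 (V? r x y)))) ⟩
    μ * sizeᵛ x                                 ∎
    where
    open ≡-Reasoning
    x = variableAt j i
    μ = degreeᵛ r x j i

  -- Divisible by all class sizes, and nonzero even without variables or constraints, hence an
  -- admissible arity.
  L : ℕ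
  L = n ! * m !

  L≢0 : NonZero L
  L≢0 = m*n≢0 (n !) (m !) {{n !≢0}} {{m !≢0}}

  sizeᵛ∣L : ∀ x → sizeᵛ x ∣ L
  sizeᵛ∣L x = ∣-trans (divides-! (sizeᵛ≢0 x) (∑-≤ _ λ y → 𝟙≤1 (V? r x y))) (m∣m*n (m !))

  sizeᶜ∣L : ∀ j → sizeᶜ j ∣ L
  sizeᶜ∣L j = ∣-trans (divides-! (sizeᶜ≢0 j) (∑-≤ _ λ j′ → 𝟙≤1 (C? r j j′))) (n∣m*n (n !))

  multiplicityᵛ : Fin n → ℕ
  multiplicityᵛ x = quotient (sizeᵛ∣L x)

  multiplicityᶜ : Fin m → ℕ
  multiplicityᶜ j = quotient (sizeᶜ∣L j)

  -- Either side times the size of the variable class is `L`.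
  multiplicity-≡ : ∀ j i →
    multiplicityᶜ j * degreeᵛ r (variableAt j i) j i ≡ multiplicityᵛ (variableAt j i)
  multiplicity-≡ j i = *-cancelʳ-≡ _ _ (sizeᵛ x) {{≢-nonZero (sizeᵛ≢0 x)}} (begin
    multiplicityᶜ j * μ * sizeᵛ x     ≡⟨ *-assoc (multiplicityᶜ j) μ (sizeᵛ x) ⟩
    multiplicityᶜ j * (μ * sizeᵛ x)   ≡⟨ cong (multiplicityᶜ j *_) (sizeᶜ-sizeᵛ j i) ⟨
    multiplicityᶜ j * sizeᶜ j         ≡⟨ _∣_.equality (sizeᶜ∣L j) ⟨
    L                                 ≡⟨ _∣_.equality (sizeᵛ∣L x) ⟩
    multiplicityᵛ x * sizeᵛ x         ∎)
    where
    open ≡-Reasoning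
    x = variableAt j i
    μ = degreeᵛ r x j i

  weightedᵛ : ∀ x → ∃[ v ] ∀ h → sum (h ∘ lookup {n = L} v) ≡
                           multiplicityᵛ x * sum (λ y → 𝟙 (V? r x y) * h y)
  weightedᵛ x =
    weighted-vector (multiplicityᵛ x) (λ y → 𝟙 (V? r x y)) (sym (_∣_.equality (sizeᵛ∣L x)))

  membersᵛ : Fin n → Vec (Fin n) L
  membersᵛ x = proj₁ (weightedᵛ x)

  ∑-membersᵛ : ∀ x h → sum (h ∘ lookup (membersᵛ x)) ≡
                       multiplicityᵛ x * sum (λ y → 𝟙 (V? r x y) * h y)
  ∑-membersᵛ x = proj₂ (weightedᵛ x)

  weightedᶜ : ∀ j → ∃[ v ] ∀ h → sum (h ∘ lookup {n = L} v) ≡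
                           multiplicityᶜ j * sum (λ j′ → 𝟙 (C? r j j′) * h j′)
  weightedᶜ j =
    weighted-vector (multiplicityᶜ j) (λ j′ → 𝟙 (C? r j j′)) (sym (_∣_.equality (sizeᶜ∣L j)))

  membersᶜ : Fin m → Vec (Fin m) L
  membersᶜ j = proj₁ (weightedᶜ j)

  ∑-membersᶜ : ∀ j h → sum (h ∘ lookup (membersᶜ j)) ≡
                       multiplicityᶜ j * sum (λ j′ → 𝟙 (C? r j j′) * h j′)
  ∑-membersᶜ j = proj₂ (weightedᶜ j)

  -- The multiplicities absorb the factor of the double count. For indicators `h` this equates the
  -- two multisets of variables.
  classes-agree : ∀ j i (h : Fin n → ℕ) →
    sum (h ∘ entry j i ∘ lookup (membersᶜ j)) ≡ sum (h ∘ lookup (membersᵛ (variableAt j i)))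
  classes-agree j i h = begin
    sum (h ∘ entry j i ∘ lookup (membersᶜ j))  ≡⟨ ∑-membersᶜ j (h ∘ entry j i) ⟩
    multiplicityᶜ j * sum (λ j′ → 𝟙 (C? r j j′) * h (entry j i j′))
                                                     ≡⟨ cong (multiplicityᶜ j *_) (double-count j i h) ⟩
    multiplicityᶜ j * (μ * N)                        ≡⟨ *-assoc (multiplicityᶜ j) μ N ⟨
    multiplicityᶜ j * μ * N                          ≡⟨ cong (_* N) (multiplicity-≡ j i) ⟩
    multiplicityᵛ x * N                              ≡⟨ ∑-membersᵛ x h ⟨
    sum (h ∘ lookup (membersᵛ x))              ∎
    where
    open ≡-Reasoning
    x = variableAt j i
    μ = degreeᵛ r x j i
    N = sum (λ y → 𝟙 (V? r x y) * h y)

  -- The averaged assignment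

  module _ (f : Operation d L) (f-sym : Symmetric f) (ν₀ : Assignment) where

    average : Assignment
    average x = f (map ν₀ (membersᵛ x))

    count-map : ∀ a {k} (v : Vec (Fin n) k) →
                count a (lookup (map ν₀ v)) ≡ sum ((λ y → 𝟙 (ν₀ y ≟ a)) ∘ lookup v)
    count-map a v = ∑-map ν₀ (λ b → 𝟙 (b ≟ a)) v

    -- The classes of `x` and `x′` coincide, but the two vectors are built from separate weights
    -- `V? r x` and `V? r x′`; equal counts suffice since `f` is symmetric.
    average-invariant : ∀ {x x′} → V r x x′ → average x ≡ average x′
    average-invariant {x} {x′} x~x′ = symmetric-count f-sym _ _ λ a → begin
      count a (lookup (map ν₀ (membersᵛ x)))   ≡⟨ class-count a x ⟩
      multiplicityᵛ x * N a x
        ≡⟨ cong₂ _*_ multiplicity-eq (N-eq (λ y → 𝟙 (ν₀ y ≟ a))) ⟩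
      multiplicityᵛ x′ * N a x′                      ≡⟨ class-count a x′ ⟨
      count a (lookup (map ν₀ (membersᵛ x′)))  ∎
      where
      open ≡-Reasoning
      N : Fin d → Fin n → ℕ
      N a x = sum (λ y → 𝟙 (V? r x y) * 𝟙 (ν₀ y ≟ a))

      class-count : ∀ a x → count a (lookup (map ν₀ (membersᵛ x))) ≡ multiplicityᵛ x * N a x
      class-count a x = trans (count-map a (membersᵛ x)) (∑-membersᵛ x _)

      same-class : ∀ y → 𝟙 (V? r x y) ≡ 𝟙 (V? r x′ y)
      same-class y = 𝟙-cong (V? r x y) (V? r x′ y) (Vᵉ.trans r (Vᵉ.sym r x~x′)) (Vᵉ.trans r x~x′)

      N-eq : ∀ h → sum (λ y → 𝟙 (V? r x y) * h y) ≡ sum (λ y → 𝟙 (V? r x′ y) * h y)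
      N-eq h = sum-cong-≗ (λ y → cong (_* h y) (same-class y))

      multiplicity-eq : multiplicityᵛ x ≡ multiplicityᵛ x′
      multiplicity-eq = *-cancelʳ-≡ _ _ (sizeᵛ x) {{≢-nonZero (sizeᵛ≢0 x)}} (begin
        multiplicityᵛ x * sizeᵛ x     ≡⟨ _∣_.equality (sizeᵛ∣L x) ⟨
        L                             ≡⟨ _∣_.equality (sizeᵛ∣L x′) ⟩
        multiplicityᵛ x′ * sizeᵛ x′   ≡⟨ cong (multiplicityᵛ x′ *_) (sum-cong-≗ same-class) ⟨
        multiplicityᵛ x′ * sizeᵛ x    ∎)

    -- `f` is applied to the tuples of `ν₀` on the class of the constraint; by `classes-agree` each
    -- row has the counts of the vector defining `average` there.
    average-satisfies : ∀ {Γ} → CSP Γ I → Polymorphism Γ f → Satisfies ν₀ → Satisfies average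
    average-satisfies I∈Γ f-poly ν₀-sat {c} c∈ with index c∈ | lookup-index c∈
    ... | j | refl = subst (_∈ᴿ tuples (rel (constraint j)))
      (lookup-ext (map f (transpose ts)) (map average (scope c₀)) rows)
      (f-poly (I∈Γ (∈-lookup j)) ts ts-sat)
      where
      c₀ = constraint j

      tuple : Fin m → Vec (Fin d) (arity (rel c₀))
      tuple j′ = map ν₀ (align c₀ (constraint j′))

      ts = map tuple (membersᶜ j)

      ts-sat : ∀ k → lookup ts k ∈ᴿ tuples (rel c₀)
      ts-sat k rewrite lookup-map k tuple (membersᶜ j) =
        align-satisfied {ν = ν₀} c₀ (constraint (lookup (membersᶜ j) k))
          (ν₀-sat (∈-lookup j)) (ν₀-sat (∈-lookup _))

      rows : ∀ i → lookup (map f (transpose ts)) i ≡ lookup (map average (scope c₀)) i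
      rows i = begin
        lookup (map f (transpose ts)) i     ≡⟨ lookup-map i f (transpose ts) ⟩
        f (lookup (transpose ts) i)         ≡⟨ symmetric-count f-sym _ _ counts ⟩
        average (variableAt j i)            ≡⟨ lookup-map i average (scope c₀) ⟨
        lookup (map average (scope c₀)) i   ∎
        where
        open ≡-Reasoning
        counts : ∀ a → count a (lookup (lookup (transpose ts) i)) ≡
                       count a (lookup (map ν₀ (membersᵛ (variableAt j i))))
        counts a = begin
          count a (lookup (lookup (transpose ts) i))
            ≡⟨ sum-cong-≗ (λ k → cong (λ b → 𝟙 (b ≟ a)) (begin
                 lookup (lookup (transpose ts) i) k  ≡⟨ lookup-transpose ts i k ⟩
                 lookup (lookup ts k) i
                   ≡⟨ cong (λ t → lookup t i) (lookup-map k tuple (membersᶜ j)) ⟩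
                 lookup (tuple (lookup (membersᶜ j) k)) i
                   ≡⟨ lookup-map i ν₀ (align c₀ (constraint (lookup (membersᶜ j) k))) ⟩
                 ν₀ (entry j i (lookup (membersᶜ j) k)) ∎)) ⟩
          sum ((λ y → 𝟙 (ν₀ y ≟ a)) ∘ entry j i ∘ lookup (membersᶜ j))
            ≡⟨ classes-agree j i (λ y → 𝟙 (ν₀ y ≟ a)) ⟩
          sum ((λ y → 𝟙 (ν₀ y ≟ a)) ∘ lookup (membersᵛ (variableAt j i)))
            ≡⟨ count-map a (membersᵛ (variableAt j i)) ⟨
          count a (lookup (map ν₀ (membersᵛ (variableAt j i)))) ∎

-- Automorphisms preserve iterated degrees

unique⇒lookup-injective : ∀ {A : Set} {xs : List A} → Unique xs → Injective _≡_ _≡_ (List.lookup xs)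
unique⇒lookup-injective (x∉xs ∷ u) {zero}  {zero}  _  = refl
unique⇒lookup-injective (x∉xs ∷ u) {zero}  {suc j} eq = contradiction eq (All.lookup x∉xs (∈-lookup j))
unique⇒lookup-injective (x∉xs ∷ u) {suc i} {zero}  eq = contradiction (sym eq) (All.lookup x∉xs (∈-lookup i))
unique⇒lookup-injective (x∉xs ∷ u) {suc i} {suc j} eq = cong suc (unique⇒lookup-injective u eq)

permutation-injective : ∀ {n} (π : Permutation′ n) → Injective _≡_ _≡_ (π ⟨$⟩ʳ_)
permutation-injective π eq = trans (sym (inverseˡ π)) (trans (cong (π ⟨$⟩ˡ_) eq) (inverseˡ π))

∈-map-injective⁻ : ∀ {A B : Set} {f : A → B} → Injective _≡_ _≡_ f →
                   ∀ {x k} {s : Vec A k} → f x ∈ᵛ map f s → x ∈ᵛ s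
∈-map-injective⁻ f-inj {s = _ ∷ _} (Anyᵛ.here eq) = Anyᵛ.here (f-inj eq)
∈-map-injective⁻ f-inj {s = _ ∷ _} (Anyᵛ.there p) = Anyᵛ.there (∈-map-injective⁻ f-inj p)

module _ {N} (σ : Permutation′ N) {P Q : Fin N → Set} (P? : Decidable P) (Q? : Decidable Q)
         (P⇒Q : ∀ {a} → P a → Q (σ ⟨$⟩ʳ a)) (Q⇒P : ∀ {a} → Q (σ ⟨$⟩ʳ a) → P a) where

  -- Both lists are duplicate-free and have the same elements.
  filter-permute : List.map (σ ⟨$⟩ʳ_) (filter P? (allFin N)) ↭ filter Q? (allFin N)
  filter-permute = ∼bag⇒↭ (unique∧set⇒bag
    (Unique.map⁺ (permutation-injective σ) (Unique.filter⁺ P? (Unique.allFin⁺ N)))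
    (Unique.filter⁺ Q? (Unique.allFin⁺ N))
    (mk⇔ to from))
    where
    to : ∀ {b} → b ∈ List.map (σ ⟨$⟩ʳ_) (filter P? (allFin N)) → b ∈ filter Q? (allFin N)
    to b∈ with _ , a∈ , refl ← ∈-map⁻ (σ ⟨$⟩ʳ_) b∈ =
      ∈-filter⁺ Q? (∈-allFin _) (P⇒Q (proj₂ (∈-filter⁻ P? {xs = allFin N} a∈)))

    from : ∀ {b} → b ∈ filter Q? (allFin N) → b ∈ List.map (σ ⟨$⟩ʳ_) (filter P? (allFin N))
    from {b} b∈ = subst (_∈ List.map (σ ⟨$⟩ʳ_) (filter P? (allFin N))) (inverseʳ σ)
      (∈-map⁺ (σ ⟨$⟩ʳ_) (∈-filter⁺ P? (∈-allFin (σ ⟨$⟩ˡ b))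
        (Q⇒P (subst Q (sym (inverseʳ σ)) (proj₂ (∈-filter⁻ Q? {xs = allFin N} b∈))))))

  map-filter-permute :
    (S : Setoid 0ℓ 0ℓ) (f g : Fin N → Setoid.Carrier S) →
    (∀ a → Setoid._≈_ S (f a) (g (σ ⟨$⟩ʳ a))) →
    Homogeneous.Permutation (Setoid._≈_ S)
      (List.map f (filter P? (allFin N))) (List.map g (filter Q? (allFin N)))
  map-filter-permute S f g f≈g = Homogeneous.trans
    (Homogeneous.refl (Pointwise.map⁺ f g∘σ (Pointwise.refl (λ {a} → f≈g a))))
    (subst (λ ys → Homogeneous.Permutation _≈_ ys (List.map g (filter Q? (allFin N))))
           (sym (map-∘ˡ (filter P? (allFin N))))
           (↭⇒↭ₛ′ (Setoid.isEquivalence S) (↭.map⁺ g filter-permute)))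
    where
    open Setoid S using (_≈_; Carrier)
    g∘σ : Fin N → Carrier
    g∘σ a = g (σ ⟨$⟩ʳ a)
    map-∘ˡ : ∀ as → List.map g∘σ as ≡ List.map g (List.map (σ ⟨$⟩ʳ_) as)
    map-∘ˡ = List.map-∘

act : ∀ {d n} → (Fin n → Fin n) → Constraint d n → Constraint d n
act π c = mkConstraint (rel c) (map π (scope c))

act-inverse : ∀ {d n} {π ρ : Fin n → Fin n} → (∀ x → π (ρ x) ≡ x) →
              (c : Constraint d n) → act π (act ρ c) ≡ c
act-inverse {π = π} {ρ} π∘ρ≗id c = cong (mkConstraint (rel c)) (begin
  map π (map ρ (scope c))   ≡⟨ map-∘ π ρ (scope c) ⟨
  map (π ∘ ρ) (scope c)     ≡⟨ map-cong π∘ρ≗id (scope c) ⟩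
  map (λ x → x) (scope c)   ≡⟨ map-id (scope c) ⟩
  scope c                   ∎)
  where open ≡-Reasoning

labelOf-act : ∀ {d n} {π : Fin n → Fin n} → Injective _≡_ _≡_ π →
              ∀ x (c : Constraint d n) → labelOf (π x) (act π c) ≡ labelOf x c
labelOf-act {π = π} π-inj x c = cong (rel c ,_) (trans
  (sym (map-∘ (λ y → does (y ≟ π x)) π (scope c)))
  (map-cong (λ y → does-⇔ (mk⇔ π-inj (cong π)) (π y ≟ π x) (y ≟ x)) (scope c)))

module Automorphism {d : ℕ} (I : Instance d) (π : Permutation′ (Instance.n I))
  (closedʳ : ∀ {c} → c ∈ Instance.constraints I → act (π ⟨$⟩ʳ_) c ∈ Instance.constraints I)
  (closedˡ : ∀ {c} → c ∈ Instance.constraints I → act (π ⟨$⟩ˡ_) c ∈ Instance.constraints I) where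

  open Instance I
  open FactorGraph I
  open DecMembership (_≟_ {n}) using (_∈?_)

  m : ℕ
  m = List.length constraints

  module _ {ρ : Fin n → Fin n} (closed : ∀ {c} → c ∈ constraints → act ρ c ∈ constraints) where

    -- Constraint nodes are list positions, so the image is read off from the membership proof.
    image : Fin m → Fin m
    image j = index (closed (∈-lookup j))

    constraint-image : ∀ j → constraint (image j) ≡ act ρ (constraint j)
    constraint-image j = sym (lookup-index (closed (∈-lookup j)))

  -- In a duplicate-free list a position is determined by its constraint, so comparing constraints
  -- suffices.
  image-inverse : ∀ {ρ ρ′} (closed : ∀ {c} → c ∈ constraints → act ρ c ∈ constraints)
                  (closed′ : ∀ {c} → c ∈ constraints → act ρ′ c ∈ constraints) →
                  (∀ x → ρ (ρ′ x) ≡ x) → ∀ j → image closed (image closed′ j) ≡ j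
  image-inverse {ρ} closed closed′ ρ∘ρ′≗id j = unique⇒lookup-injective distinct (begin
    constraint (image closed (image closed′ j))  ≡⟨ constraint-image closed (image closed′ j) ⟩
    act ρ (constraint (image closed′ j))         ≡⟨ cong (act ρ) (constraint-image closed′ j) ⟩
    act ρ (act _ (constraint j))                 ≡⟨ act-inverse ρ∘ρ′≗id (constraint j) ⟩
    constraint j                                 ∎)
    where open ≡-Reasoning

  π̂ : Permutation′ m
  π̂ = Perm.permutation (image closedʳ) (image closedˡ)
    (image-inverse closedʳ closedˡ (λ _ → inverseʳ π)) (image-inverse closedˡ closedʳ (λ _ → inverseˡ π))

  label-invariant : ∀ x j → label x j ≡ label (π ⟨$⟩ʳ x) (π̂ ⟨$⟩ʳ j)
  label-invariant x j = sym (trans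
    (cong (labelOf (π ⟨$⟩ʳ x)) (constraint-image closedʳ j))
    (labelOf-act (permutation-injective π) x (constraint j)))

  incident⇒ : ∀ {x j} → x ∈ᵛ scope (constraint j) → (π ⟨$⟩ʳ x) ∈ᵛ scope (constraint (π̂ ⟨$⟩ʳ j))
  incident⇒ {x} {j} x∈ = subst (λ c → (π ⟨$⟩ʳ x) ∈ᵛ scope c) (sym (constraint-image closedʳ j))
    (∈ᵛ.∈-map⁺ (π ⟨$⟩ʳ_) x∈)

  incident⇐ : ∀ {x j} → (π ⟨$⟩ʳ x) ∈ᵛ scope (constraint (π̂ ⟨$⟩ʳ j)) → x ∈ᵛ scope (constraint j)
  incident⇐ {x} {j} πx∈ = ∈-map-injective⁻ (permutation-injective π)
    (subst (λ c → (π ⟨$⟩ʳ x) ∈ᵛ scope c) (constraint-image closedʳ j) πx∈)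

  -- Simultaneous induction on `k`: `π` and `π̂` map the neighbours of a node bijectively to those
  -- of its image and preserve labels.
  δ-invariantᵛ : ∀ k x → Setoid._≈_ (Degree d k) (δ k (inj₁ x)) (δ k (inj₁ (π ⟨$⟩ʳ x)))
  δ-invariantᶜ : ∀ k j → Setoid._≈_ (Degree d k) (δ k (inj₂ j)) (δ k (inj₂ (π̂ ⟨$⟩ʳ j)))
  δ-invariantᵛ zero    x = refl
  δ-invariantᵛ (suc k) x = map-filter-permute π̂
    (λ j → x ∈? scope (constraint j)) (λ j → (π ⟨$⟩ʳ x) ∈? scope (constraint j)) incident⇒ incident⇐
    (setoid (Label d) ×ₛ Degree d k) _ _ λ j → label-invariant x j , δ-invariantᶜ k j
  δ-invariantᶜ zero    j = refl
  δ-invariantᶜ (suc k) j = map-filter-permute π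
    (λ x → x ∈? scope (constraint j)) (λ x → x ∈? scope (constraint (π̂ ⟨$⟩ʳ j))) incident⇒ incident⇐
    (setoid (Label d) ×ₛ Degree d k) _ _ λ x → label-invariant x j , δ-invariantᵛ k x

-- The indicator instance

funToFin-cong : ∀ {k l} {f g : Fin k → Fin l} → f ≗ g → funToFin f ≡ funToFin g
funToFin-cong {zero}  f≗g = refl
funToFin-cong {suc k} f≗g = cong₂ combine (f≗g zero) (funToFin-cong (f≗g ∘ suc))

_≟ᶜ_ : ∀ {d n} → DecidableEquality (Constraint d n)
mkConstraint R s ≟ᶜ mkConstraint R′ s′ with R ≟ᴿ R′
... | no R≢R′ = no λ { refl → R≢R′ refl }
... | yes refl with Vec.≡-dec _≟_ s s′
...   | no s≢s′  = no λ { refl → s≢s′ refl }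
...   | yes refl = yes refl

module Indicator {d : ℕ} (Γ : Language d) (ℓ : ℕ) where

  n : ℕ
  n = d ^ ℓ

  encode : Vec (Fin d) ℓ → Fin n
  encode v = funToFin (lookup v)

  coordinate : Fin ℓ → Fin n → Fin d
  coordinate j x = finToFun x j

  coordinate-encode : ∀ j v → coordinate j (encode v) ≡ lookup v j
  coordinate-encode j v = finToFun-funToFin (lookup v) j

  coordinates-injective : ∀ {x y} → (∀ j → coordinate j x ≡ coordinate j y) → x ≡ y
  coordinates-injective {x} {y} eq = trans (sym (funToFin-finToFin {ℓ} {d} x))
    (trans (funToFin-cong eq) (funToFin-finToFin {ℓ} {d} y))

  Indicated : Constraint d n → Set
  Indicated c = ∀ j → map (coordinate j) (scope c) ∈ᴿ tuples (rel c)

  Indicated? : Decidable Indicated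
  Indicated? c = all? λ j → funToFin (lookup (map (coordinate j) (scope c))) Subset.∈? tuples (rel c)

  constraintsWith : Relation d → List (Constraint d n)
  constraintsWith R = List.map (λ i → mkConstraint R (tabulate (finToFun i))) (allFin (n ^ arity R))

  ∈-constraintsWith : ∀ c → c ∈ constraintsWith (rel c)
  ∈-constraintsWith c = subst (_∈ constraintsWith (rel c))
    (cong (mkConstraint (rel c)) (trans
      (tabulate-cong (finToFun-funToFin (lookup (scope c)))) (tabulate∘lookup (scope c))))
    (∈-map⁺ (λ i → mkConstraint (rel c) (tabulate (finToFun i))) (∈-allFin (funToFin (lookup (scope c)))))

  candidates : List (Constraint d n)
  candidates = concatMap constraintsWith Γ

  indicator : Instance d
  indicator = record
    { n           = n
    -- Candidates can repeat if `Γ` lists a relation twice, whereas constraints form a set.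
    ; constraints = deduplicate _≟ᶜ_ (filter Indicated? candidates)
    ; distinct    = deduplicate-! _≟ᶜ_ (filter Indicated? candidates)
    }

  open Instance indicator using (constraints; Satisfies)

  ∈-indicator⁺ : ∀ {c} → rel c ∈ Γ → Indicated c → c ∈ constraints
  ∈-indicator⁺ {c} R∈Γ ind = ∈-deduplicate⁺ _≟ᶜ_ (∈-filter⁺ Indicated?
    (∈-concatMap⁺ constraintsWith (lose R∈Γ (∈-constraintsWith c))) ind)

  ∈-indicator⁻ : ∀ {c} → c ∈ constraints → rel c ∈ Γ × Indicated c
  ∈-indicator⁻ {c} c∈ = rel∈Γ Γ (∈-concatMap⁻ constraintsWith {xs = Γ} (proj₁ c∈filter)) , proj₂ c∈filter
    where
    c∈filter = ∈-filter⁻ Indicated? {xs = candidates} (∈-deduplicate⁻ _≟ᶜ_ (filter Indicated? candidates) c∈)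
    rel∈Γ : ∀ Γ → Any (λ R → c ∈ constraintsWith R) Γ → rel c ∈ Γ
    rel∈Γ (R ∷ Γ) (here p) with _ , _ , refl ← ∈-map⁻ _ p = here refl
    rel∈Γ (R ∷ Γ) (there p) = there (rel∈Γ Γ p)

  indicator∈CSP : CSP Γ indicator
  indicator∈CSP c∈ = proj₁ (∈-indicator⁻ c∈)

  projection-satisfies : ∀ j → Satisfies (coordinate j)
  projection-satisfies j c∈ = proj₂ (∈-indicator⁻ c∈) j

  module _ (σ : Permutation′ ℓ) where

    permuteVariable : Fin n → Fin n
    permuteVariable x = funToFin (λ j → coordinate (σ ⟨$⟩ʳ j) x)

    coordinate-permute : ∀ j x → coordinate j (permuteVariable x) ≡ coordinate (σ ⟨$⟩ʳ j) x
    coordinate-permute j x = finToFun-funToFin (λ j → coordinate (σ ⟨$⟩ʳ j) x) j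

    -- Projection `j` after permuting is projection `σ ⟨$⟩ʳ j`, and a constraint of the instance is
    -- satisfied by all projections.
    permute-closed : ∀ {c} → c ∈ constraints → act permuteVariable c ∈ constraints
    permute-closed {c} c∈ with R∈Γ , ind ← ∈-indicator⁻ c∈ = ∈-indicator⁺ R∈Γ λ j →
      subst (_∈ᴿ tuples (rel c))
        (trans (sym (map-cong (coordinate-permute j) (scope c)))
               (map-∘ (coordinate j) permuteVariable (scope c)))
        (ind (σ ⟨$⟩ʳ j))

  -- The action reverses composition, whence the order of `τ` and `σ` in the hypothesis.
  permute-inverse : ∀ (σ τ : Permutation′ ℓ) → (∀ j → τ ⟨$⟩ʳ (σ ⟨$⟩ʳ j) ≡ j) →
                    ∀ x → permuteVariable σ (permuteVariable τ x) ≡ x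
  permute-inverse σ τ τ∘σ≗id x = coordinates-injective λ j →
    trans (coordinate-permute σ j (permuteVariable τ x)) (trans
      (coordinate-permute τ (σ ⟨$⟩ʳ j) x) (cong (λ i → coordinate i x) (τ∘σ≗id j)))

  permute-∼δ : ∀ σ x → FactorGraph._∼δ_ indicator (inj₁ x) (inj₁ (permuteVariable σ x))
  permute-∼δ σ x k = Automorphism.δ-invariantᵛ indicator
    (Perm.permutation (permuteVariable σ) (permuteVariable (Perm.flip σ))
      (permute-inverse σ (Perm.flip σ) (λ _ → inverseˡ σ))
      (permute-inverse (Perm.flip σ) σ (λ _ → inverseʳ σ)))
    (permute-closed σ) (permute-closed (Perm.flip σ)) k x

  module _ {ν : Fin n → Fin d} where

    -- The rows of the transpose of `ts`, encoded as variables, form a scope that projection `j`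
    -- maps to `lookup ts j`, a tuple of `R`. Hence this scope with `R` is a constraint that `ν`
    -- satisfies.
    solution-polymorphism : Satisfies ν → Polymorphism Γ (ν ∘ encode)
    solution-polymorphism ν-sat {R} R∈Γ ts ts∈R =
      subst (_∈ᴿ tuples R) (sym (map-∘ ν encode (transpose ts)))
        (ν-sat (∈-indicator⁺ {mkConstraint R (map encode (transpose ts))} R∈Γ λ j →
          subst (_∈ᴿ tuples R) (lookup-ext (lookup ts j)
            (map (coordinate j) (map encode (transpose ts))) (column j)) (ts∈R j)))
      where
      open ≡-Reasoning
      column : ∀ j i → lookup (lookup ts j) i ≡ lookup (map (coordinate j) (map encode (transpose ts))) i
      column j i = begin
        lookup (lookup ts j) i                                ≡⟨ lookup-transpose ts i j ⟨
        lookup (lookup (transpose ts) i) j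
          ≡⟨ coordinate-encode j (lookup (transpose ts) i) ⟨
        coordinate j (encode (lookup (transpose ts) i))
          ≡⟨ cong (coordinate j) (lookup-map i encode (transpose ts)) ⟨
        coordinate j (lookup (map encode (transpose ts)) i)
          ≡⟨ lookup-map i (coordinate j) (map encode (transpose ts)) ⟨
        lookup (map (coordinate j) (map encode (transpose ts))) i ∎

    -- A vector and its rearrangement are variables related by an automorphism, so `ν` takes the
    -- same value on them.
    solution-symmetric : (∀ x x′ → FactorGraph._∼δ_ indicator (inj₁ x) (inj₁ x′) → ν x ≡ ν x′) →
                         Symmetric (ν ∘ encode)
    solution-symmetric ν-inv xs σ = trans (ν-inv _ _ (permute-∼δ σ (encode xs)))
      (cong ν (coordinates-injective λ j → begin
        coordinate j (permuteVariable σ (encode xs))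
          ≡⟨ coordinate-permute σ j (encode xs) ⟩
        coordinate (σ ⟨$⟩ʳ j) (encode xs)                          ≡⟨ coordinate-encode (σ ⟨$⟩ʳ j) xs ⟩
        lookup xs (σ ⟨$⟩ʳ j)
          ≡⟨ lookup∘tabulate (λ i → lookup xs (σ ⟨$⟩ʳ i)) j ⟨
        lookup (tabulate λ i → lookup xs (σ ⟨$⟩ʳ i)) j
          ≡⟨ coordinate-encode j (tabulate λ i → lookup xs (σ ⟨$⟩ʳ i)) ⟨
        coordinate j (encode (tabulate λ i → lookup xs (σ ⟨$⟩ʳ i))) ∎))
      where open ≡-Reasoning

-- The two implications

theorem3p3 : (d : ℕ) (Γ : Language d) →
    HasSymmetricPolymorphismsOfAllArities Γ
    ⇔
    ((I : Instance d) → CSP Γ I → Instance.Satisfiable I →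
    ∃[ ν ] (Instance.Satisfies I ν ×
    (∀ x x′ → FactorGraph._∼δ_ I (inj₁ x) (inj₁ x′) → ν x ≡ ν x′)))
theorem3p3 d Γ = mk⇔ invariant-solution symmetric-polymorphism
  where
  InvariantSolution : Instance d → Set
  InvariantSolution I = ∃[ ν ] (Instance.Satisfies I ν ×
    (∀ x x′ → FactorGraph._∼δ_ I (inj₁ x) (inj₁ x′) → ν x ≡ ν x′))

  invariant-solution : HasSymmetricPolymorphismsOfAllArities Γ →
                       (I : Instance d) → CSP Γ I → Instance.Satisfiable I → InvariantSolution I
  invariant-solution polymorphisms I I∈Γ (ν₀ , ν₀-sat) =
    average f f-sym ν₀ , average-satisfies f f-sym ν₀ I∈Γ f-poly ν₀-sat ,
    -- Equal iterated degrees of depth `r` already place both variables in one class of the stable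
    -- partition.
    λ x x′ x∼x′ → average-invariant f f-sym ν₀ (δ-refines-V r r ≤-refl (x∼x′ r))
    where
    open Refinement I
    r = proj₁ eventually-stable
    open StableRefinement I r (proj₂ eventually-stable)
    polymorphism = polymorphisms L {{L≢0}}
    f = proj₁ polymorphism
    f-poly = proj₁ (proj₂ polymorphism)
    f-sym = proj₂ (proj₂ polymorphism)

  symmetric-polymorphism : ((I : Instance d) → CSP Γ I → Instance.Satisfiable I → InvariantSolution I) →
                           HasSymmetricPolymorphismsOfAllArities Γ
  symmetric-polymorphism invariant ℓ@(suc _) =
    ν ∘ encode , solution-polymorphism ν-sat , solution-symmetric ν-inv
    where
    open Indicator Γ ℓ
    -- As the arity is positive, the first projection exists and witnesses satisfiability.
    solution = invariant indicator indicator∈CSP (coordinate zero , projection-satisfies zero)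
    ν = proj₁ solution
    ν-sat = proj₁ (proj₂ solution)
    ν-inv = proj₂ (proj₂ solution)
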